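{- Let $P$ be a countable dcpo satisfying $\sigma(P\times P)=\sigma(P)\times\sigma(P)$. Then the Scott space $\Sigma P$ is sober if and only if the following holds: whenever $A\in\operatorname{Irr}_c(\Sigma P)$, $x\in A$, and $y_0\le y_1\le\cdots$ is a sequence in $P$ with supremum $y$, \[ \bigl(\forall n\in\mathbb N\ \exists a_n\in A:\ x\le a_n,\ y_n\le a_n\bigr)\ \Longrightarrow\ \exists a\in A:\ x\le a,\ y\le a. \]
   Context: All posets and directed sets are nonempty; countable sets may be finite; $\mathbb N=\{0,1,2,\ldots\}$. A subset $D$ of a poset is directed if any two of its elements have a common upper bound in $D$. A dcpo is a poset in which every directed subset has a supremum. Write $\mathord{\downarrow}x=\{y:y\le x\}$. For a dcpo $P$, an upper set $U\subseteq P$ is Scott open if for every directed $D\subseteq P$, $\bigvee D\in U$ implies $D\cap U\neq\emptyset$; the Scott open sets form the Scott topology $\sigma(P)$, and $\Sigma P=(P,\sigma(P))$ is the Scott space. A nonempty Scott-closed set $A$ is irreducible if any two open sets meeting $A$ have an intersection meeting $A$; $\operatorname{Irr}_c(\Sigma P)$ is the set of irreducible Scott-closed sets. $\Sigma P$ is sober if each $A\in\operatorname{Irr}_c(\Sigma P)$ equals $\mathord{\downarrow}a$ for a unique $a\in P$. $\sigma(P\times P)$ is the Scott topology of the coordinatewise order on $P\times P$, and $\sigma(P)\times\sigma(P)$ denotes the ordinary product topology. -}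

module Defs where

open import Level using (Level; _⊔_; suc)
open import Data.Nat.Base using (ℕ)
open import Data.Product using (∃; ∃₂; ∃!; _×_; _,_)
open import Function.Bundles using (Injection)
open import Relation.Binary.Bundles using (Poset)
open import Relation.Binary.PropositionalEquality using (setoid)
open import Relation.Unary
  using (Pred; _∈_; _⊆_; _≐_; _≬_; _∩_; ∁; Satisfiable; _⟨×⟩_)

private
  variable
    c ℓ₁ ℓ₂ : Level

-- The product topology, as a family of subsets, for two topologies given
-- as families of subsets.
infixr 2 _×ᵗ_

_×ᵗ_ : ∀ {x y ℓ t₁ t₂} {X : Set x} {Y : Set y} →
       Pred (Pred X ℓ) t₁ → Pred (Pred Y ℓ) t₂ →
       Pred (Pred (X × Y) ℓ) (x ⊔ y ⊔ suc ℓ ⊔ t₁ ⊔ t₂)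
(𝒰 ×ᵗ 𝒱) W = ∀ x y → (x , y) ∈ W →
  ∃₂ λ U V → U ∈ 𝒰 × V ∈ 𝒱 × x ∈ U × y ∈ V × (U ⟨×⟩ V) ⊆ W

module _ (P : Poset c ℓ₁ ℓ₂) where
  open Poset P

  -- Subsets of P live at one universe level, large enough for every subset
  -- definable from the order and for existential quantification over P.
  Subset : Set (suc (c ⊔ ℓ₁ ⊔ ℓ₂))
  Subset = Pred Carrier (c ⊔ ℓ₁ ⊔ ℓ₂)

  IsSupremum : ∀ {p} → Pred Carrier p → Carrier → Set (c ⊔ ℓ₂ ⊔ p)
  IsSupremum D s =
    (∀ x → x ∈ D → x ≤ s) × (∀ u → (∀ x → x ∈ D → x ≤ u) → s ≤ u)

  Range : (ℕ → Carrier) → Pred Carrier ℓ₁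
  Range y z = ∃ λ n → y n ≈ z

  IsDirected : Pred Subset (c ⊔ ℓ₁ ⊔ ℓ₂)
  IsDirected D = Satisfiable D ×
    (∀ x y → x ∈ D → y ∈ D → ∃ λ z → z ∈ D × x ≤ z × y ≤ z)

  IsUpper : Pred Subset (c ⊔ ℓ₁ ⊔ ℓ₂)
  IsUpper U = ∀ x y → x ≤ y → x ∈ U → y ∈ U

  -- The Scott topology.  The supremum is passed as a relation, so that the
  -- definition makes sense before P is known to be directed complete.
  σ : Pred Subset (suc (c ⊔ ℓ₁ ⊔ ℓ₂))
  σ U = IsUpper U ×
    (∀ D → IsDirected D → ∀ s → IsSupremum D s → s ∈ U → D ≬ U)

  IsScottClosed : Pred Subset (suc (c ⊔ ℓ₁ ⊔ ℓ₂))
  IsScottClosed A = ∁ A ∈ σ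

  Irrᶜ : Pred Subset (suc (c ⊔ ℓ₁ ⊔ ℓ₂))
  Irrᶜ A = Satisfiable A × IsScottClosed A ×
    (∀ U V → U ∈ σ → V ∈ σ → U ≬ A → V ≬ A → (U ∩ V) ≬ A)

  ↓ : Carrier → Pred Carrier ℓ₂
  ↓ x y = y ≤ x

  IsSober : Set (suc (c ⊔ ℓ₁ ⊔ ℓ₂))
  IsSober = ∀ A → A ∈ Irrᶜ → ∃! _≈_ λ a → A ≐ ↓ a

  Countable : Set (c ⊔ ℓ₁)
  Countable = Injection Eq.setoid (setoid ℕ)

record Dcpo c ℓ₁ ℓ₂ : Set (suc (c ⊔ ℓ₁ ⊔ ℓ₂)) where
  field
    poset            : Poset c ℓ₁ ℓ₂
  open Poset poset public
  field
    nonempty         : Carrier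
    directedComplete : ∀ D → IsDirected poset D → ∃ (IsSupremum poset D)

{-# OPTIONS --safe #-}
-- Only directedness of an irreducible closed set A needs work: its supremum
-- then lies in A and generates it.  The set W of pairs without a common upper
-- bound in A is Scott open in P × P: in a countable poset directed suprema are
-- suprema of sequences, so the chain condition, applied to one coordinate at a
-- time, shows that the complement of W is closed under directed suprema.  If
-- (x , y) ∈ W with x, y ∈ A, the hypothesis on the topologies gives an open
-- rectangle U × V ⊆ W around (x , y), and irreducibility gives z ∈ U ∩ V ∩ A;
-- but then (z , z) ∈ W although z is a common upper bound of z and z in A.
module Submission where

open import Defs
open import Level using (_⊔_)
open import Axiom.ExcludedMiddle using (ExcludedMiddle)
open import Data.Nat.Base using (ℕ; zero; suc)
open import Data.Product using (∃; _×_; _,_; proj₁; proj₂)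
open import Data.Product.Relation.Binary.Pointwise.NonDependent using (×-poset)
open import Function.Bundles using (_⇔_; mk⇔; Injection)
open import Relation.Binary.Bundles using (Poset)
open import Relation.Binary.PropositionalEquality as ≡ using (_≡_)
open import Relation.Nullary using (Dec; yes; no)
open import Relation.Nullary.Decidable using (decidable-stable)
open import Relation.Unary using (Pred; _∈_; _⊆_; _≐_; ∁)

module _ {c ℓ₁ ℓ₂} (Q : Poset c ℓ₁ ℓ₂) where
  open Poset Q

  ChainCondition : Pred (Subset Q) (c ⊔ ℓ₁ ⊔ ℓ₂)
  ChainCondition A = ∀ x → x ∈ A →
    ∀ (y : ℕ → Carrier) (y∞ : Carrier) →
    (∀ n → y n ≤ y (suc n)) → IsSupremum Q (Range Q y) y∞ →
    (∀ n → ∃ λ aₙ → aₙ ∈ A × x ≤ aₙ × y n ≤ aₙ) →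
    ∃ λ a → a ∈ A × x ≤ a × y∞ ≤ a

  -- The generator `a` serves as the common bound: it dominates every `aₙ`, hence every `y n`, hence
  -- their supremum.
  principal⇒chainCondition : ∀ {A} a → A ≐ ↓ Q a → ChainCondition A
  principal⇒chainCondition a (A⊆↓a , ↓a⊆A) x x∈A y y∞ _ (_ , least) bounds =
    a , ↓a⊆A {a} refl , A⊆↓a x∈A ,
    least a λ z (n , yₙ≈z) → let _ , aₙ∈A , _ , yₙ≤aₙ = bounds n in
      trans (reflexive (Eq.sym yₙ≈z)) (trans yₙ≤aₙ (A⊆↓a aₙ∈A))

  proj₁-directed : ∀ {D} → IsDirected (×-poset Q Q) D →
                   IsDirected Q (λ x → ∃ λ y → (x , y) ∈ D)
  proj₁-directed (((x₀ , y₀) , d₀) , dir) =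
    (x₀ , y₀ , d₀) ,
    λ x x′ (y , d) (y′ , d′) →
      let (x″ , y″) , d″ , (x≤x″ , _) , (x′≤x″ , _) = dir _ _ d d′
      in x″ , (y″ , d″) , x≤x″ , x′≤x″

  proj₂-directed : ∀ {D} → IsDirected (×-poset Q Q) D →
                   IsDirected Q (λ y → ∃ λ x → (x , y) ∈ D)
  proj₂-directed (((x₀ , y₀) , d₀) , dir) =
    (y₀ , x₀ , d₀) ,
    λ y y′ (x , d) (x′ , d′) →
      let (x″ , y″) , d″ , (_ , y≤y″) , (_ , y′≤y″) = dir _ _ d d′
      in y″ , (x″ , d″) , y≤y″ , y′≤y″

  -- If `w` bounds the first coordinates, then `(w , v)` bounds `D`, since all second coordinates
  -- lie below `v` already; leastness of `(u , v)` gives `u ≤ w`.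
  proj₁-supremum : ∀ {D : Subset (×-poset Q Q)} {u v} →
                   IsSupremum (×-poset Q Q) D (u , v) →
                   IsSupremum Q (λ x → ∃ λ y → (x , y) ∈ D) u
  proj₁-supremum {v = v} (upper , least) =
    (λ x (y , d) → proj₁ (upper _ d)) ,
    λ w w-upper → proj₁ (least (w , v) λ (x , y) d →
      w-upper x (y , d) , proj₂ (upper _ d))

  proj₂-supremum : ∀ {D : Subset (×-poset Q Q)} {u v} →
                   IsSupremum (×-poset Q Q) D (u , v) →
                   IsSupremum Q (λ y → ∃ λ x → (x , y) ∈ D) v
  proj₂-supremum {u = u} (upper , least) =
    (λ y (x , d) → proj₂ (upper _ d)) ,
    λ w w-upper → proj₂ (least (u , w) λ (x , y) d →
      proj₁ (upper _ d) , w-upper y (x , d))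

  cofinal-supremum : ∀ {D : Subset Q} {y s} → (∀ n → y n ∈ D) →
                     (∀ x → x ∈ D → ∃ λ n → x ≤ y n) →
                     IsSupremum Q D s → IsSupremum Q (Range Q y) s
  cofinal-supremum {y = y} y∈D cofinal (upper , least) =
    (λ z (n , yₙ≈z) → trans (reflexive (Eq.sym yₙ≈z)) (upper (y n) (y∈D n))) ,
    λ u u-upper → least u λ x x∈D →
      let n , x≤yₙ = cofinal x x∈D in trans x≤yₙ (u-upper (y n) (n , Eq.refl))

  module _ (em : ExcludedMiddle (c ⊔ ℓ₁ ⊔ ℓ₂)) where

    scottClosed-lower : ∀ {A} → IsScottClosed Q A → ∀ {x y} → x ≤ y → y ∈ A → x ∈ A
    scottClosed-lower (∁A-upper , _) x≤y y∈A =
      decidable-stable em λ x∉A → ∁A-upper _ _ x≤y x∉A y∈A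

    scottClosed-supremum : ∀ {A D} → IsScottClosed Q A → IsDirected Q D → D ⊆ A →
                           ∀ {s} → IsSupremum Q D s → s ∈ A
    scottClosed-supremum (_ , ∁A-inaccessible) D-dir D⊆A {s} sup =
      decidable-stable em λ s∉A →
        let _ , d∈D , d∉A = ∁A-inaccessible _ D-dir s sup s∉A in d∉A (D⊆A d∈D)

    module _ (countable : Countable Q) {D : Subset Q} (D-directed : IsDirected Q D) where
      open Injection countable using (to; injective)

      private
        HasIndex : ℕ → Set (c ⊔ ℓ₁ ⊔ ℓ₂)
        HasIndex n = ∃ λ e → e ∈ D × to e ≡ n

        extend : ∀ {n} → Dec (HasIndex n) → ∃ D → ∃ D
        extend (no _)              d         = d
        extend (yes (e , e∈D , _)) (d , d∈D) =
          let z , z∈D , _ = proj₂ D-directed d e d∈D e∈D in z , z∈D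

        extend-≤ : ∀ {n} (i? : Dec (HasIndex n)) d → proj₁ d ≤ proj₁ (extend i? d)
        extend-≤ (no _)              d         = refl
        extend-≤ (yes (e , e∈D , _)) (d , d∈D) =
          let _ , _ , d≤z , _ = proj₂ D-directed d e d∈D e∈D in d≤z

        extend-covers : ∀ {x} → x ∈ D → (i? : Dec (HasIndex (to x))) → ∀ d →
                        x ≤ proj₁ (extend i? d)
        extend-covers x∈D (no none) d with () ← none (_ , x∈D , ≡.refl)
        extend-covers x∈D (yes (e , e∈D , eq)) (d , d∈D) =
          let _ , _ , _ , e≤z = proj₂ D-directed d e d∈D e∈D
          in trans (reflexive (Eq.sym (injective eq))) e≤z

        -- Stage `suc n` climbs above the element of `D` with code `n` if there is one, which
        -- excluded middle decides, and otherwise stays put. Every element of `D` is thus absorbed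
        -- at some stage.
        chain : ℕ → ∃ D
        chain zero    = proj₁ D-directed
        chain (suc n) = extend {n} em (chain n)

      cofinalSequence : ∃ λ y → (∀ n → y n ≤ y (suc n)) × (∀ n → y n ∈ D) ×
                                (∀ x → x ∈ D → ∃ λ n → x ≤ y n)
      cofinalSequence =
        (λ n → proj₁ (chain n)) ,
        (λ n → extend-≤ {n} em (chain n)) ,
        (λ n → proj₂ (chain n)) ,
        -- The element with code `n` is handled in passing from stage `n` to stage `suc n`, hence
        -- the successor.
        λ x x∈D → suc (to x) , extend-covers x∈D em (chain (to x))

    module _ (countable : Countable Q) {A} (A-closed : IsScottClosed Q A)
             (A-chain : ChainCondition A) where

      BoundedIn : Carrier → Carrier → Set (c ⊔ ℓ₁ ⊔ ℓ₂)
      BoundedIn x y = ∃ λ a → a ∈ A × x ≤ a × y ≤ a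

      boundedIn-sym : ∀ {x y} → BoundedIn x y → BoundedIn y x
      boundedIn-sym (a , a∈A , x≤a , y≤a) = a , a∈A , y≤a , x≤a

      boundedIn-anti : ∀ {x x′ y y′} → x ≤ x′ → y ≤ y′ →
                       BoundedIn x′ y′ → BoundedIn x y
      boundedIn-anti x≤x′ y≤y′ (a , a∈A , x′≤a , y′≤a) =
        a , a∈A , trans x≤x′ x′≤a , trans y≤y′ y′≤a

      -- Countability lifts the chain condition from increasing sequences to directed sets: a
      -- cofinal sequence in `D` has the same supremum `s`.
      boundedIn-supremum : ∀ {x D s} → IsDirected Q D → IsSupremum Q D s →
                           (∀ d → d ∈ D → BoundedIn x d) → BoundedIn x s
      boundedIn-supremum {x} {D} {s} D-dir@((d , d∈D) , _) sup bounded =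
        let y , y-mono , y∈D , cofinal = cofinalSequence countable D-dir
            _ , a∈A , x≤a , _ = bounded d d∈D
        -- The chain condition requires `x ∈ A`: as `D` is inhabited, `x` lies below some element of
        -- the lower set `A`.
        in A-chain x (scottClosed-lower A-closed x≤a a∈A) y s y-mono
             (cofinal-supremum {D} y∈D cofinal sup) λ n → bounded (y n) (y∈D n)

      -- The supremum is taken in two passes: for each first coordinate `x` the second coordinates
      -- are raised to `v`, and then, with `v` fixed, the first coordinates are raised to `u`.
      boundedIn-supremum₂ : ∀ {D u v} → IsDirected (×-poset Q Q) D →
                            IsSupremum (×-poset Q Q) D (u , v) →
                            (∀ x y → (x , y) ∈ D → BoundedIn x y) → BoundedIn u v
      boundedIn-supremum₂ {D} D-dir sup bounded =
        boundedIn-sym (boundedIn-supremum (proj₁-directed D-dir) (proj₁-supremum {D} sup)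
          λ x (y , d) → boundedIn-sym
            (boundedIn-supremum (proj₂-directed D-dir) (proj₂-supremum {D} sup)
              λ y′ (x′ , d′) →
                -- The pair `(x , y′)` mixes coordinates of two members of `D` and need not lie in
                -- `D`, but directedness puts a member of `D` above it.
                let _ , d″ , (x≤x″ , _) , (_ , y′≤y″) = proj₂ D-dir _ _ d d′
                in boundedIn-anti x≤x″ y′≤y″ (bounded _ _ d″)))

      Unbounded : Subset (×-poset Q Q)
      Unbounded = ∁ λ (x , y) → BoundedIn x y

      unbounded-open : Unbounded ∈ σ (×-poset Q Q)
      unbounded-open =
        (λ _ _ (x≤x′ , y≤y′) unb b → unb (boundedIn-anti x≤x′ y≤y′ b)) ,
        λ D D-dir s sup unb → decidable-stable em λ disjoint →
          unb (boundedIn-supremum₂ D-dir sup λ x y d →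
            -- If `D` misses `Unbounded`, each of its pairs is bounded in `A`, by double negation.
            decidable-stable em λ unb′ → disjoint ((x , y) , d , unb′))

      irreducible⇒directed : σ (×-poset Q Q) ⊆ (σ Q ×ᵗ σ Q) →
                             A ∈ Irrᶜ Q → IsDirected Q A
      irreducible⇒directed σ⊆ (inhabited , _ , irr) =
        inhabited , λ x y x∈A y∈A → decidable-stable em λ unb →
          let U , V , U-open , V-open , x∈U , y∈V , U×V⊆ = σ⊆ unbounded-open x y unb
              z , (z∈U , z∈V) , z∈A =
                irr U V U-open V-open (x , x∈U , x∈A) (y , y∈V , y∈A)
          in U×V⊆ (z∈U , z∈V) (z , z∈A , refl , refl)

corollary5p3 : ∀ {c ℓ₁ ℓ₂} → ExcludedMiddle (c ⊔ ℓ₁ ⊔ ℓ₂) →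
    (P : Dcpo c ℓ₁ ℓ₂) → let open Dcpo P in
    Countable poset →
    σ (×-poset poset poset) ≐ (σ poset ×ᵗ σ poset) →
    IsSober poset ⇔
    (∀ A → A ∈ Irrᶜ poset → ∀ x → x ∈ A →
    ∀ (y : ℕ → Carrier) (y∞ : Carrier) →
    (∀ n → y n ≤ y (suc n)) → IsSupremum poset (Range poset y) y∞ →
    (∀ n → ∃ λ aₙ → aₙ ∈ A × x ≤ aₙ × y n ≤ aₙ) →
    ∃ λ a → a ∈ A × x ≤ a × y∞ ≤ a)
corollary5p3 em P countable (σ⊆ , _) = mk⇔ sober⇒chain chain⇒sober
  where
  open Dcpo P

  sober⇒chain : IsSober poset → ∀ A → A ∈ Irrᶜ poset → ChainCondition poset A
  sober⇒chain sober A A-irr =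
    let a , A≐↓a , _ = sober A A-irr in principal⇒chainCondition poset a A≐↓a

  chain⇒sober : (∀ A → A ∈ Irrᶜ poset → ChainCondition poset A) → IsSober poset
  chain⇒sober chain A A-irr@(_ , A-closed , _) =
    let A-directed = irreducible⇒directed poset em countable A-closed
                       (chain A A-irr) σ⊆ A-irr
        s , sup = directedComplete A A-directed
        s∈A = scottClosed-supremum poset em A-closed A-directed (λ x∈A → x∈A) sup
    in s ,
       ((λ {x} → proj₁ sup x) , λ x≤s → scottClosed-lower poset em A-closed x≤s s∈A) ,
       λ (A⊆↓t , ↓t⊆A) → antisym (A⊆↓t s∈A) (proj₁ sup _ (↓t⊆A refl))
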